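{- Let $p$ be a prime of the form $p=6g+1$ or $p=6g-1$ with $g\ge 1$ an integer. For all integers $n\ge 0$, $k\ge 0$ and all integers $r$ with $1\le r\le p-1$, we have \[ \mathcal{EO}_u\left(4\left(p^{2k+2}n+p^{2k+1}r+\frac{p^{2k+2}-1}{24}\right)\right)\equiv 0 \pmod{2}. \]
   Context: For a positive integer $k$, let $f_k:=(q^k;q^k)_\infty=\prod_{i=1}^\infty(1-q^{ki})$. The integers $\mathcal{EO}_u(n)$, $n\ge 0$, are defined by $\sum_{n=0}^\infty \mathcal{EO}_u(n)q^n=\dfrac{f_4^2}{f_2^2}$. -}

module Defs where

open import Data.Bool.Base using (if_then_else_)
open import Data.Fin.Base using (toℕ)
open import Data.Integer.Base using (ℤ; _+_; _-_; -_; _*_; 0ℤ; 1ℤ)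
open import Data.Integer.Properties
  using (+-*-semiring; +-identityˡ; +-identityʳ; *-identityʳ; *-zeroʳ; +-assoc;
         +-comm; +-inverseˡ)
open import Data.Nat.Base as ℕ
  using (ℕ; zero; suc; _∸_; _≤_; _<_; _≤′_; ≤′-refl; ≤′-step; z≤n; s≤s; NonZero; _≡ᵇ_)
import Data.Nat.Properties as ℕ
open import Relation.Binary.PropositionalEquality
  using (_≡_; refl; sym; trans; cong; cong₂; module ≡-Reasoning)

open import Algebra.Properties.Semiring.Sum +-*-semiring using (sum⁺-syntax)

-- Formal power series over ℤ: the coefficient of qⁿ is the value at n.
Series : Set
Series = ℕ → ℤ

infixl 7 _⊛_ _⊘_
infixl 6 _⊖_

q^_ : ℕ → Series
(q^ m) n = if m ≡ᵇ n then 1ℤ else 0ℤ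

_⊖_ : Series → Series → Series
(a ⊖ b) n = a n - b n

_⊛_ : Series → Series → Series
(a ⊛ b) n = ∑[ i ≤ n ] (a (toℕ i) * b (n ∸ toℕ i))

-- Long division; meaningful only when b has constant term 1, in which case
-- it is the quotient (see ⊘-⊛).
_⊘_ : Series → Series → Series
(a ⊘ b) zero    = a 0
(a ⊘ b) (suc n) = ((λ m → a (suc m) - a 0 * b (suc m)) ⊘ b) n

qProduct : ℕ → ℕ → Series
qProduct k zero    = q^ 0
qProduct k (suc N) = qProduct k N ⊛ (q^ 0 ⊖ q^ (k ℕ.* suc N))

-- f k = ∏_{i ≥ 1} (1 - q^{ki}).  The factors with i > n do not affect the
-- coefficient of qⁿ (see f-stable), so the first n factors determine it.
f : (k : ℕ) → .{{_ : NonZero k}} → Series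
f k n = qProduct k n n

EOᵤ : ℕ → ℤ
EOᵤ = (f 4 ⊛ f 4) ⊘ (f 2 ⊛ f 2)

⊘-⊛ : ∀ a b → b 0 ≡ 1ℤ → ∀ n → ((a ⊘ b) ⊛ b) n ≡ a n
⊘-⊛ a b b₀ zero = begin
  a 0 * b 0 + 0ℤ  ≡⟨ +-identityʳ _ ⟩
  a 0 * b 0       ≡⟨ cong (a 0 *_) b₀ ⟩
  a 0 * 1ℤ        ≡⟨ *-identityʳ _ ⟩
  a 0             ∎
  where open ≡-Reasoning
⊘-⊛ a b b₀ (suc n) = begin
  x + ((a′ ⊘ b) ⊛ b) n   ≡⟨ cong (x +_) (⊘-⊛ a′ b b₀ n) ⟩
  x + (a (suc n) - x)    ≡⟨ +-comm x _ ⟩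
  (a (suc n) - x) + x    ≡⟨ +-assoc (a (suc n)) _ x ⟩
  a (suc n) + (- x + x)  ≡⟨ cong (a (suc n) +_) (+-inverseˡ x) ⟩
  a (suc n) + 0ℤ         ≡⟨ +-identityʳ _ ⟩
  a (suc n)              ∎
  where
  open ≡-Reasoning
  x = a 0 * b (suc n)
  a′ : Series
  a′ m = a (suc m) - a 0 * b (suc m)

EOᵤ-spec : ∀ n → (EOᵤ ⊛ (f 2 ⊛ f 2)) n ≡ (f 4 ⊛ f 4) n
EOᵤ-spec = ⊘-⊛ (f 4 ⊛ f 4) (f 2 ⊛ f 2) refl

⊛-trivial : ∀ a b n → (∀ j → j ≤ n → b j ≡ (q^ 0) j) → (a ⊛ b) n ≡ a n
⊛-trivial a b zero    h = begin
  a 0 * b 0 + 0ℤ  ≡⟨ +-identityʳ _ ⟩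
  a 0 * b 0       ≡⟨ cong (a 0 *_) (h 0 z≤n) ⟩
  a 0 * 1ℤ        ≡⟨ *-identityʳ _ ⟩
  a 0             ∎
  where open ≡-Reasoning
⊛-trivial a b (suc n) h = begin
  a 0 * b (suc n) + ((λ m → a (suc m)) ⊛ b) n
    ≡⟨ cong₂ _+_ (trans (cong (a 0 *_) (h (suc n) ℕ.≤-refl)) (*-zeroʳ (a 0)))
                 (⊛-trivial (λ m → a (suc m)) b n (λ j j≤n → h j (ℕ.m≤n⇒m≤1+n j≤n))) ⟩
  0ℤ + a (suc n)
    ≡⟨ +-identityˡ _ ⟩
  a (suc n) ∎
  where open ≡-Reasoning

q^-below : ∀ {m n} → n < m → (q^ m) n ≡ 0ℤ
q^-below {suc m} {zero}  _         = refl
q^-below {suc m} {suc n} (s≤s n<m) = q^-below n<m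

f-stable : ∀ k .{{_ : NonZero k}} {n N} → n ≤ N → qProduct k N n ≡ f k n
f-stable k n≤N = go (ℕ.≤⇒≤′ n≤N)
  where
  go : ∀ {n N} → n ≤′ N → qProduct k N n ≡ f k n
  go ≤′-refl = refl
  go {n} {suc N} (≤′-step n≤′N) = trans
    (⊛-trivial (qProduct k N) _ n λ j j≤n →
      trans (cong (λ x → (q^ 0) j - x)
              (q^-below (ℕ.≤-trans (s≤s (ℕ.≤-trans j≤n (ℕ.≤′⇒≤ n≤′N)))
                                   (ℕ.m≤n*m (suc N) k))))
            (+-identityʳ _))
    (go n≤′N)

{-# OPTIONS --safe #-}

-- Squaring a series over 𝔽₂ substitutes q² for q, so f₂² ≡ f₄ and f₄² ≡ f₄ f₂² modulo 2,
-- whence EOᵤ ≡ f₄ and EOᵤ(4m) is congruent to the coefficient of q^m in f₁.  By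
-- Euler's pentagonal number theorem (in Shanks' finite form) that coefficient is
-- even unless 24m + 1 is a square.  For the m of the theorem,
-- 24m + 1 = p^{2k+1} (p + 24(pn + r)) with p dividing neither 24 nor r, so p
-- divides 24m + 1 to an odd power.
module Submission where

open import Defs
open import Data.Nat using (ℕ; _+_; _*_; _∸_; _^_; _/_; _≤_)
open import Data.Nat.Primality using (Prime)
open import Data.Integer using (+_)
open import Data.Integer.Divisibility using (_∣_)
open import Data.Sum using (_⊎_)
open import Relation.Binary.PropositionalEquality using (_≡_)

open import Data.Integer using (ℤ; ∣_∣; -[1+_])
import Data.Integer as ℤ
import Data.Integer.Properties as ℤ
open import Data.Nat using (zero; suc; _<_; z≤n; s≤s; NonZero; parity; nonTrivial⇒≢1)
open import Data.Nat.Divisibility as ℕ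
  using (divides; ∣m+n∣m⇒∣n; ∣-refl; ∣m⇒∣m*n; m∣m*n; ∣1⇒≡1; ∣⇒≤)
open import Data.Nat.DivMod using (m*n/n≡m)
open import Data.Nat.Primality using (euclidsLemma; prime⇒nonZero; prime⇒nonTrivial)
open import Data.Nat.Properties
open import Data.Nat.Tactic.RingSolver using (solve-∀)
open import Data.Parity.Base
  using (Parity; 0ℙ; 1ℙ; _⁻¹)
  renaming (_+_ to infixl 6 _⊕_; _*_ to infixl 7 _⊗_)
import Data.Parity.Properties as ℙ
open import Data.Product using (∃-syntax; _,_; proj₁; proj₂)
open import Data.Sum using (inj₁; inj₂; [_,_]′)
open import Function using (_∘_; id)
open import Algebra.Properties.CommutativeSemigroup ℙ.+-commutativeSemigroup
  using () renaming (interchange to ℙ-interchange)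
open import Relation.Binary.PropositionalEquality
  using (refl; sym; trans; cong; cong₂; subst; _≗_; module ≡-Reasoning)
open import Relation.Nullary using (¬_; contradiction)

-- Reduction of integers and of power series modulo 2

par : ℤ → Parity
par z = parity ∣ z ∣

parity-suc : ∀ n → parity (suc n) ≡ parity n ⁻¹
parity-suc n = sym (ℙ.⁻¹-selfInverse (ℙ.suc-homo-⁻¹ n))

⁻¹-+-⁻¹ : ∀ x y → x ⁻¹ ⊕ y ⁻¹ ≡ x ⊕ y
⁻¹-+-⁻¹ 0ℙ y = ℙ.⁻¹-involutive y
⁻¹-+-⁻¹ 1ℙ y = refl

par-⊖ : ∀ m n → par (m ℤ.⊖ n) ≡ parity m ⊕ parity n
par-⊖ zero    zero    = refl
par-⊖ zero    (suc n) = refl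
par-⊖ (suc m) zero    = sym (ℙ.+-identityʳ _)
par-⊖ (suc m) (suc n) = begin
  par (suc m ℤ.⊖ suc n)            ≡⟨ cong par (ℤ.[1+m]⊖[1+n]≡m⊖n m n) ⟩
  par (m ℤ.⊖ n)                    ≡⟨ par-⊖ m n ⟩
  parity m ⊕ parity n              ≡⟨ ⁻¹-+-⁻¹ (parity m) (parity n) ⟨
  parity m ⁻¹ ⊕ parity n ⁻¹        ≡⟨ cong₂ _⊕_ (parity-suc m) (parity-suc n) ⟨
  parity (suc m) ⊕ parity (suc n)  ∎
  where open ≡-Reasoning

par-+ : ∀ x y → par (x ℤ.+ y) ≡ par x ⊕ par y
par-+ (+ m)    (+ n)    = ℙ.+-homo-+ m n
par-+ (+ m)    -[1+ n ] = par-⊖ m (suc n)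
par-+ -[1+ m ] (+ n)    = trans (par-⊖ n (suc m)) (ℙ.+-comm (parity n) _)
par-+ -[1+ m ] -[1+ n ] =
  trans (cong (parity ∘ suc) (sym (+-suc m n))) (ℙ.+-homo-+ (suc m) (suc n))

par-- : ∀ x y → par (x ℤ.- y) ≡ par x ⊕ par y
par-- x y = trans (par-+ x (ℤ.- y)) (cong (λ n → par x ⊕ parity n) (ℤ.∣-i∣≡∣i∣ y))

par-* : ∀ x y → par (x ℤ.* y) ≡ par x ⊗ par y
par-* x y = trans (cong parity (ℤ.∣i*j∣≡∣i∣*∣j∣ x y)) (ℙ.*-homo-* ∣ x ∣ ∣ y ∣)

parity≡0⇒2∣ : ∀ n → parity n ≡ 0ℙ → 2 ℕ.∣ n
parity≡0⇒2∣ zero          _  = divides 0 refl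
parity≡0⇒2∣ (suc (suc n)) eq with parity≡0⇒2∣ n eq
... | divides q refl = divides (suc q) refl

𝔽₂Series : Set
𝔽₂Series = ℕ → Parity

infixl 7 _·_
infixl 6 _⊞_

reduce : Series → 𝔽₂Series
reduce a n = par (a n)

_⊞_ : 𝔽₂Series → 𝔽₂Series → 𝔽₂Series
(a ⊞ b) n = a n ⊕ b n

-- The recursion copies how the sum in `⊛` unfolds: its first term splits off and the left factor
-- moves on to its tail.
_·_ : 𝔽₂Series → 𝔽₂Series → 𝔽₂Series
(a · b) zero    = a 0 ⊗ b 0
(a · b) (suc n) = a 0 ⊗ b (suc n) ⊕ ((a ∘ suc) · b) n

reduce-⊛ : ∀ a b → reduce (a ⊛ b) ≗ reduce a · reduce b
reduce-⊛ a b zero    = begin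
  par (a 0 ℤ.* b 0 ℤ.+ ℤ.0ℤ)  ≡⟨ cong par (ℤ.+-identityʳ (a 0 ℤ.* b 0)) ⟩
  par (a 0 ℤ.* b 0)           ≡⟨ par-* (a 0) (b 0) ⟩
  par (a 0) ⊗ par (b 0)       ∎
  where open ≡-Reasoning
reduce-⊛ a b (suc n) = begin
  par (a 0 ℤ.* b (suc n) ℤ.+ ((a ∘ suc) ⊛ b) n)
    ≡⟨ par-+ (a 0 ℤ.* b (suc n)) _ ⟩
  par (a 0 ℤ.* b (suc n)) ⊕ par (((a ∘ suc) ⊛ b) n)
    ≡⟨ cong₂ _⊕_ (par-* (a 0) (b (suc n))) (reduce-⊛ (a ∘ suc) b n) ⟩
  (reduce a · reduce b) (suc n) ∎
  where open ≡-Reasoning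

·-cong : ∀ {a a′ b b′} → a ≗ a′ → b ≗ b′ → a · b ≗ a′ · b′
·-cong a≗ b≗ zero    = cong₂ _⊗_ (a≗ 0) (b≗ 0)
·-cong a≗ b≗ (suc n) =
  cong₂ _⊕_ (cong₂ _⊗_ (a≗ 0) (b≗ (suc n))) (·-cong (a≗ ∘ suc) b≗ n)

·-distribˡ-⊞ : ∀ a b c → a · (b ⊞ c) ≗ (a · b) ⊞ (a · c)
·-distribˡ-⊞ a b c zero    = ℙ.*-distribˡ-+ (a 0) (b 0) (c 0)
·-distribˡ-⊞ a b c (suc n) = trans
  (cong₂ _⊕_ (ℙ.*-distribˡ-+ (a 0) (b (suc n)) (c (suc n))) (·-distribˡ-⊞ (a ∘ suc) b c n))
  (ℙ-interchange (a 0 ⊗ b (suc n)) _ _ _)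

-- Mirror image of the defining recursion: here the last term of the convolution splits off and the
-- right factor moves on to its tail.
·-sucʳ : ∀ a b n → (a · b) (suc n) ≡ a (suc n) ⊗ b 0 ⊕ (a · (b ∘ suc)) n
·-sucʳ a b zero    = ℙ.+-comm (a 0 ⊗ b 1) _
·-sucʳ a b (suc n) = begin
  x ⊕ ((a ∘ suc) · b) (suc n)  ≡⟨ cong (x ⊕_) (·-sucʳ (a ∘ suc) b n) ⟩
  x ⊕ (y ⊕ z)                  ≡⟨ ℙ.+-assoc x y z ⟨
  x ⊕ y ⊕ z                    ≡⟨ cong (_⊕ z) (ℙ.+-comm x y) ⟩
  y ⊕ x ⊕ z                    ≡⟨ ℙ.+-assoc y x z ⟩
  y ⊕ (x ⊕ z)                  ∎
  where
  open ≡-Reasoning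
  x = a 0 ⊗ b (suc (suc n))
  y = a (suc (suc n)) ⊗ b 0
  z = ((a ∘ suc) · (b ∘ suc)) n

-- A series with constant term 1 is not a zero divisor. The constant terms of `a` and `b` agree;
-- removing their equal contributions leaves the same equation between the tails. This is what
-- determines the quotient `EOᵤ` modulo 2.
·-cancelʳ : ∀ a b c → c 0 ≡ 1ℙ → a · c ≗ b · c → a ≗ b
·-cancelʳ a b c c₀ eq zero = begin
  a 0        ≡⟨ ℙ.*-identityʳ (a 0) ⟨
  a 0 ⊗ 1ℙ   ≡⟨ cong (a 0 ⊗_) c₀ ⟨
  a 0 ⊗ c 0  ≡⟨ eq 0 ⟩
  b 0 ⊗ c 0  ≡⟨ cong (b 0 ⊗_) c₀ ⟩
  b 0 ⊗ 1ℙ   ≡⟨ ℙ.*-identityʳ (b 0) ⟩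
  b 0        ∎
  where open ≡-Reasoning
·-cancelʳ a b c c₀ eq (suc n) = ·-cancelʳ (a ∘ suc) (b ∘ suc) c c₀ tails n
  where
  tails : (a ∘ suc) · c ≗ (b ∘ suc) · c
  tails m = ℙ.+-cancelˡ-≡ (a 0 ⊗ c (suc m)) _ _
    (trans (eq (suc m))
      (cong (λ x → x ⊗ c (suc m) ⊕ ((b ∘ suc) · c) m)
        (sym (·-cancelʳ a b c c₀ eq 0))))

-- Multiplication by q^d and by 1 - q^d

shift : ℕ → 𝔽₂Series → 𝔽₂Series
shift zero    a n       = a n
shift (suc d) a zero    = 0ℙ
shift (suc d) a (suc n) = shift d a n

1-q^_⊙_ : ℕ → 𝔽₂Series → 𝔽₂Series
1-q^ d ⊙ a = a ⊞ shift d a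

shift-cong : ∀ d {a b} → a ≗ b → shift d a ≗ shift d b
shift-cong zero    a≗b n       = a≗b n
shift-cong (suc d) a≗b zero    = refl
shift-cong (suc d) a≗b (suc n) = shift-cong d a≗b n

shift-⊞ : ∀ d a b → shift d (a ⊞ b) ≗ shift d a ⊞ shift d b
shift-⊞ zero    a b n       = refl
shift-⊞ (suc d) a b zero    = refl
shift-⊞ (suc d) a b (suc n) = shift-⊞ d a b n

shift-shift : ∀ d e a → shift d (shift e a) ≗ shift (d + e) a
shift-shift zero    e a n       = refl
shift-shift (suc d) e a zero    = refl
shift-shift (suc d) e a (suc n) = shift-shift d e a n

shift-below : ∀ {d n} a → n < d → shift d a n ≡ 0ℙ
shift-below {suc d} {zero}  a _         = refl
shift-below {suc d} {suc n} a (s≤s n<d) = shift-below a n<d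

⊙-cong : ∀ d {a b} → a ≗ b → 1-q^ d ⊙ a ≗ 1-q^ d ⊙ b
⊙-cong d a≗b n = cong₂ _⊕_ (a≗b n) (shift-cong d a≗b n)

shift-⊙ : ∀ e d a → shift e (1-q^ d ⊙ a) ≗ shift e a ⊞ shift (e + d) a
shift-⊙ e d a n =
  trans (shift-⊞ e a (shift d a) n) (cong (shift e a n ⊕_) (shift-shift e d a n))

⊙-comm : ∀ d e a → 1-q^ d ⊙ (1-q^ e ⊙ a) ≗ 1-q^ e ⊙ (1-q^ d ⊙ a)
⊙-comm d e a n = begin
  (x ⊕ y) ⊕ shift d (1-q^ e ⊙ a) n   ≡⟨ cong ((x ⊕ y) ⊕_) (shift-⊙ d e a n) ⟩
  (x ⊕ y) ⊕ (z ⊕ shift (d + e) a n)  ≡⟨ ℙ-interchange x y z _ ⟩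
  (x ⊕ z) ⊕ (y ⊕ shift (d + e) a n)
    ≡⟨ cong (λ k → (x ⊕ z) ⊕ (y ⊕ shift k a n)) (+-comm d e) ⟩
  (x ⊕ z) ⊕ (y ⊕ shift (e + d) a n)  ≡⟨ cong ((x ⊕ z) ⊕_) (shift-⊙ e d a n) ⟨
  (x ⊕ z) ⊕ shift e (1-q^ d ⊙ a) n   ∎
  where
  open ≡-Reasoning
  x = a n
  y = shift e a n
  z = shift d a n

·-q^ : ∀ d a → a · reduce (q^ d) ≗ shift d a
·-q^ zero    a zero    = ℙ.*-identityʳ (a 0)
·-q^ zero    a (suc n) =
  trans (cong (_⊕ ((a ∘ suc) · reduce (q^ 0)) n) (ℙ.*-zeroʳ (a 0))) (·-q^ zero (a ∘ suc) n)
·-q^ (suc d) a zero    = ℙ.*-zeroʳ (a 0)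
·-q^ (suc d) a (suc n) = begin
  (a · reduce (q^ suc d)) (suc n)
    ≡⟨ ·-sucʳ a (reduce (q^ suc d)) n ⟩
  a (suc n) ⊗ 0ℙ ⊕ (a · reduce (q^ d)) n
    ≡⟨ cong₂ _⊕_ (ℙ.*-zeroʳ (a (suc n))) (·-q^ d a n) ⟩
  shift d a n ∎
  where open ≡-Reasoning

reduce-qProduct-suc : ∀ k N →
  reduce (qProduct k (suc N)) ≗ 1-q^ (k * suc N) ⊙ reduce (qProduct k N)
reduce-qProduct-suc k N n = begin
  par ((qProduct k N ⊛ (q^ 0 ⊖ q^ d)) n)  ≡⟨ reduce-⊛ (qProduct k N) (q^ 0 ⊖ q^ d) n ⟩
  (u · reduce (q^ 0 ⊖ q^ d)) n
    ≡⟨ ·-cong {u} (λ _ → refl) (λ m → par-- ((q^ 0) m) ((q^ d) m)) n ⟩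
  (u · (reduce (q^ 0) ⊞ reduce (q^ d))) n
    ≡⟨ ·-distribˡ-⊞ u (reduce (q^ 0)) (reduce (q^ d)) n ⟩
  (u · reduce (q^ 0)) n ⊕ (u · reduce (q^ d)) n
    ≡⟨ cong₂ _⊕_ (·-q^ 0 u n) (·-q^ d u n) ⟩
  (1-q^ d ⊙ u) n ∎
  where
  open ≡-Reasoning
  d = k * suc N
  u = reduce (qProduct k N)

-- The substitution q ↦ q²

dilate : 𝔽₂Series → 𝔽₂Series
dilate a zero          = a 0
dilate a (suc zero)    = 0ℙ
dilate a (suc (suc n)) = dilate (a ∘ suc) n

-- The bound on `j` is for `f`, whose coefficients come from different truncations: `f-stable`
-- matches them with a fixed `qProduct k n` up to degree `n`.
dilate-cong-≤ : ∀ {a b} n → (∀ {j} → j ≤ n → a j ≡ b j) → dilate a n ≡ dilate b n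
dilate-cong-≤ zero          eq = eq z≤n
dilate-cong-≤ (suc zero)    eq = refl
dilate-cong-≤ (suc (suc n)) eq = dilate-cong-≤ n (λ j≤n → eq (s≤s (m≤n⇒m≤1+n j≤n)))

dilate-cong : ∀ {a b} → a ≗ b → dilate a ≗ dilate b
dilate-cong a≗b n = dilate-cong-≤ n (λ {j} _ → a≗b j)

dilate-⊞ : ∀ a b → dilate (a ⊞ b) ≗ dilate a ⊞ dilate b
dilate-⊞ a b zero          = refl
dilate-⊞ a b (suc zero)    = refl
dilate-⊞ a b (suc (suc n)) = dilate-⊞ (a ∘ suc) (b ∘ suc) n

dilate-shift : ∀ d a → dilate (shift d a) ≗ shift (d + d) (dilate a)
dilate-shift zero    a n = refl
-- The rewrite exposes two successors in `suc d + suc d`, in step with the recursion of `dilate`.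
dilate-shift (suc d) a n rewrite +-suc d d = go n
  where
  go : dilate (shift (suc d) a) ≗ shift (suc (suc (d + d))) (dilate a)
  go zero          = refl
  go (suc zero)    = refl
  go (suc (suc n)) = dilate-shift d a n

dilate-double : ∀ a n → dilate a (2 * n) ≡ a n
dilate-double a zero    = refl
dilate-double a (suc n) =
  trans (cong (dilate a) (2*suc n)) (dilate-double (a ∘ suc) n)
  where
  2*suc : ∀ n → 2 * suc n ≡ suc (suc (2 * n))
  2*suc = solve-∀

-- The Frobenius map: the two outermost terms of the convolution are equal and cancel in
-- characteristic 2, leaving the square of the tail two degrees lower. A surviving diagonal term is
-- its own square root in 𝔽₂.
·-square : ∀ a → a · a ≗ dilate a
·-square a zero          = *-idem (a 0)
  where
  *-idem : ∀ x → x ⊗ x ≡ x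
  *-idem 0ℙ = refl
  *-idem 1ℙ = refl
·-square a (suc zero)    =
  trans (cong (_⊕ a 1 ⊗ a 0) (ℙ.*-comm (a 0) (a 1))) (ℙ.p+p≡0ℙ (a 1 ⊗ a 0))
·-square a (suc (suc n)) = begin
  a 0 ⊗ x ⊕ ((a ∘ suc) · a) (suc n)
    ≡⟨ cong₂ _⊕_ (ℙ.*-comm (a 0) x) (·-sucʳ (a ∘ suc) a n) ⟩
  x ⊗ a 0 ⊕ (x ⊗ a 0 ⊕ t)
    ≡⟨ ℙ.+-assoc (x ⊗ a 0) _ t ⟨
  x ⊗ a 0 ⊕ x ⊗ a 0 ⊕ t
    ≡⟨ cong (_⊕ t) (ℙ.p+p≡0ℙ (x ⊗ a 0)) ⟩
  t
    ≡⟨ ·-square (a ∘ suc) n ⟩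
  dilate (a ∘ suc) n ∎
  where
  open ≡-Reasoning
  x = a (suc (suc n))
  t = ((a ∘ suc) · (a ∘ suc)) n

-- The products `f` and the quotient `EOᵤ` modulo 2

reduce-qProduct-2* : ∀ k N →
  reduce (qProduct (2 * k) N) ≗ dilate (reduce (qProduct k N))
reduce-qProduct-2* k zero    zero          = refl
reduce-qProduct-2* k zero    (suc zero)    = refl
reduce-qProduct-2* k zero    (suc (suc n)) = sym (dilate-0 n)
  where
  dilate-0 : dilate (λ _ → 0ℙ) ≗ (λ _ → 0ℙ)
  dilate-0 zero          = refl
  dilate-0 (suc zero)    = refl
  dilate-0 (suc (suc n)) = dilate-0 n
reduce-qProduct-2* k (suc N) n = begin
  par (qProduct (2 * k) (suc N) n)        ≡⟨ reduce-qProduct-suc (2 * k) N n ⟩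
  (1-q^ (2 * k * suc N) ⊙ v) n            ≡⟨ cong (λ e → (1-q^ e ⊙ v) n) (double k (suc N)) ⟩
  (1-q^ (d + d) ⊙ v) n                    ≡⟨ ⊙-cong (d + d) (reduce-qProduct-2* k N) n ⟩
  (1-q^ (d + d) ⊙ dilate u) n             ≡⟨ cong (dilate u n ⊕_) (dilate-shift d u n) ⟨
  dilate u n ⊕ dilate (shift d u) n       ≡⟨ dilate-⊞ u (shift d u) n ⟨
  dilate (1-q^ d ⊙ u) n                   ≡⟨ dilate-cong (reduce-qProduct-suc k N) n ⟨
  dilate (reduce (qProduct k (suc N))) n  ∎
  where
  open ≡-Reasoning
  d = k * suc N
  u = reduce (qProduct k N)
  v = reduce (qProduct (2 * k) N)
  double : ∀ k m → 2 * k * m ≡ k * m + k * m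
  double = solve-∀

reduce-f-2* : ∀ k .{{_ : NonZero k}} .{{_ : NonZero (2 * k)}} →
  reduce (f (2 * k)) ≗ dilate (reduce (f k))
reduce-f-2* k n =
  trans (reduce-qProduct-2* k n n) (dilate-cong-≤ n (λ j≤n → cong par (f-stable k j≤n)))

-- With u = f₁, the denominator f₂² is u(q⁴) and the numerator f₄² is u(q⁸) = u(q⁴)².
reduce-EOᵤ : reduce EOᵤ ≗ dilate (dilate (reduce (f 1)))
reduce-EOᵤ = ·-cancelʳ (reduce EOᵤ) u₄ u₄ refl λ n → begin
  (reduce EOᵤ · u₄) n                  ≡⟨ ·-cong {reduce EOᵤ} (λ _ → refl) f₂² n ⟨
  (reduce EOᵤ · reduce (f 2 ⊛ f 2)) n  ≡⟨ reduce-⊛ EOᵤ (f 2 ⊛ f 2) n ⟨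
  par ((EOᵤ ⊛ (f 2 ⊛ f 2)) n)          ≡⟨ cong par (EOᵤ-spec n) ⟩
  par ((f 4 ⊛ f 4) n)                  ≡⟨ reduce-⊛ (f 4) (f 4) n ⟩
  (reduce (f 4) · reduce (f 4)) n      ≡⟨ ·-cong f₄ f₄ n ⟩
  (u₄ · u₄) n                          ∎
  where
  open ≡-Reasoning
  u₄ = dilate (dilate (reduce (f 1)))
  f₄ : reduce (f 4) ≗ u₄
  f₄ n = trans (reduce-f-2* 2 n) (dilate-cong (reduce-f-2* 1) n)
  f₂² : reduce (f 2 ⊛ f 2) ≗ u₄
  f₂² n = trans (reduce-⊛ (f 2) (f 2) n)
    (trans (·-square (reduce (f 2)) n) (dilate-cong (reduce-f-2* 1) n))

EOᵤ-4* : ∀ m → par (EOᵤ (4 * m)) ≡ par (f 1 m)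
EOᵤ-4* m = begin
  par (EOᵤ (4 * m))                ≡⟨ reduce-EOᵤ (4 * m) ⟩
  dilate (dilate u) (4 * m)        ≡⟨ cong (dilate (dilate u)) (*-assoc 2 2 m) ⟩
  dilate (dilate u) (2 * (2 * m))  ≡⟨ dilate-double (dilate u) (2 * m) ⟩
  dilate u (2 * m)                 ≡⟨ dilate-double u m ⟩
  par (f 1 m)                      ∎
  where
  open ≡-Reasoning
  u = reduce (f 1)

-- Euler's pentagonal number theorem modulo 2

tri : ℕ → ℕ
tri zero    = 0
tri (suc n) = tri n + suc n

2*tri : ∀ n → 2 * tri n ≡ n * n + n
2*tri zero    = refl
2*tri (suc n) = begin
  2 * (tri n + suc n)    ≡⟨ *-distribˡ-+ 2 (tri n) (suc n) ⟩
  2 * tri n + 2 * suc n  ≡⟨ cong (_+ 2 * suc n) (2*tri n) ⟩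
  n * n + n + 2 * suc n  ≡⟨ lemma n ⟩
  suc n * suc n + suc n  ∎
  where
  open ≡-Reasoning
  lemma : ∀ n → n * n + n + 2 * suc n ≡ suc n * suc n + suc n
  lemma = solve-∀

24*+tri : ∀ m n → 24 * (m + tri n) + 1 ≡ 24 * m + 12 * (n * n + n) + 1
24*+tri m n = trans (lemma m (tri n)) (cong (λ x → 24 * m + 12 * x + 1) (2*tri n))
  where
  lemma : ∀ m t → 24 * (m + t) + 1 ≡ 24 * m + 12 * (2 * t) + 1
  lemma = solve-∀

-- The number `n * n + tri n` is the generalized pentagonal number n(3n+1)/2; multiplying by 24 and
-- adding 1 completes the square.
pentagonal⁺ : ∀ n → 24 * (n * n + tri n) + 1 ≡ (6 * n + 1) * (6 * n + 1)
pentagonal⁺ n = trans (24*+tri (n * n) n) (lemma n)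
  where
  lemma : ∀ n → 24 * (n * n) + 12 * (n * n + n) + 1 ≡ (6 * n + 1) * (6 * n + 1)
  lemma = solve-∀

-- With m = n + 1 this is the other family m(3m-1)/2, and 6n + 5 = 6m - 1.
pentagonal⁻ : ∀ n → 24 * (suc n * suc n + tri n) + 1 ≡ (6 * n + 5) * (6 * n + 5)
pentagonal⁻ n = trans (24*+tri (suc n * suc n) n) (lemma n)
  where
  lemma : ∀ n → 24 * (suc n * suc n) + 12 * (n * n + n) + 1 ≡ (6 * n + 5) * (6 * n + 5)
  lemma = solve-∀

-- ∏ (1 - q^i) over s < i ≤ s + d
segment : ℕ → ℕ → 𝔽₂Series
segment s zero    = reduce (q^ 0)
segment s (suc d) = 1-q^ (s + suc d) ⊙ segment s d

-- `segment` grows at its upper end; commuting the factors lets the lowest one be split off instead,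
-- as the telescoping in `shanks-step` requires.
segment-sucˡ : ∀ s d → segment s (suc d) ≗ 1-q^ (suc s) ⊙ segment (suc s) d
segment-sucˡ s zero    n = cong (λ e → (1-q^ e ⊙ reduce (q^ 0)) n) (+-comm s 1)
segment-sucˡ s (suc d) n = begin
  (1-q^ (s + suc (suc d)) ⊙ segment s (suc d)) n
    ≡⟨ ⊙-cong (s + suc (suc d)) (segment-sucˡ s d) n ⟩
  (1-q^ (s + suc (suc d)) ⊙ (1-q^ (suc s) ⊙ X)) n
    ≡⟨ cong (λ e → (1-q^ e ⊙ (1-q^ (suc s) ⊙ X)) n) (+-suc s (suc d)) ⟩
  (1-q^ (suc s + suc d) ⊙ (1-q^ (suc s) ⊙ X)) n
    ≡⟨ ⊙-comm (suc s + suc d) (suc s) X n ⟩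
  (1-q^ (suc s) ⊙ segment (suc s) (suc d)) n ∎
  where
  open ≡-Reasoning
  X = segment (suc s) d

reduce-qProduct-1 : ∀ N → reduce (qProduct 1 N) ≗ segment 0 N
reduce-qProduct-1 zero    n = refl
reduce-qProduct-1 (suc N) n = begin
  par (qProduct 1 (suc N) n)                          ≡⟨ reduce-qProduct-suc 1 N n ⟩
  (1-q^ (1 * suc N) ⊙ reduce (qProduct 1 N)) n
    ≡⟨ cong (λ e → (1-q^ e ⊙ reduce (qProduct 1 N)) n) (*-identityˡ (suc N)) ⟩
  (1-q^ suc N ⊙ reduce (qProduct 1 N)) n  ≡⟨ ⊙-cong (suc N) (reduce-qProduct-1 N) n ⟩
  segment 0 (suc N) n                     ∎
  where open ≡-Reasoning

-- For n = s + d, the partial sum over j ≤ s of Shanks' expression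
-- Σ_j (-1)^j ∏_{j < i ≤ n} (1 - q^i) q^{jn + j(j+1)/2}.
shanks : ℕ → ℕ → ℕ → 𝔽₂Series
shanks n zero    d = segment 0 d
shanks n (suc s) d = shanks n s (suc d) ⊞ shift (suc s * n + tri (suc s)) (segment (suc s) d)

-- Passing from n to n + 1 changes each summand by a telescoping difference.
shanks-step : ∀ m s d → m ≡ s + d →
  shanks (suc m) s (suc d) ≗ shanks m s d ⊞ shift (suc s * suc m + tri s) (segment s d)
shanks-step m zero    d refl x =
  cong (λ e → (segment 0 d x) ⊕ shift e (segment 0 d) x) (lemma d)
  where
  lemma : ∀ d → suc d ≡ 1 * suc d + 0
  lemma = solve-∀
shanks-step m (suc s) d eq x = begin
  shanks (suc m) s (suc (suc d)) x ⊕ shift e (segment (suc s) (suc d)) x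
    -- The new summand splits into `B ⊕ C` by its highest factor 1 - q^(m+1), the inductive
    -- correction into `A ⊕ B` by its lowest factor 1 - q^(s+1). The two copies of `B` cancel, `A`
    -- completes the sum for `m`, and `C` is the next correction.
    ≡⟨ cong₂ _⊕_ (shanks-step m s (suc d) (trans eq (sym (+-suc s d))) x) shift-e ⟩
  S ⊕ shift a (segment s (suc d)) x ⊕ (B ⊕ C)
    ≡⟨ cong (λ y → S ⊕ y ⊕ (B ⊕ C))
            (trans (shift-cong a (segment-sucˡ s d) x) (shift-⊙ a (suc s) X x)) ⟩
  S ⊕ (A ⊕ B) ⊕ (B ⊕ C)
    ≡⟨ cancel-middle S A B C ⟩
  S ⊕ A ⊕ C
    ≡⟨ cong₂ (λ i j → S ⊕ shift i X x ⊕ shift j X x) (e-A s m (tri s)) (e-C s m (tri s)) ⟩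
  shanks m (suc s) d x ⊕ shift (suc (suc s) * suc m + tri (suc s)) X x ∎
  where
  open ≡-Reasoning
  X = segment (suc s) d
  S = shanks m s (suc d) x
  a = suc s * suc m + tri s
  e = suc s * suc m + tri (suc s)
  A = shift a X x
  B = shift (a + suc s) X x
  C = shift (a + suc s + suc m) X x
  shift-e : shift e (segment (suc s) (suc d)) x ≡ B ⊕ C
  shift-e = begin
    shift e (1-q^ (suc s + suc d) ⊙ X) x
      ≡⟨ cong₂ (λ i j → shift i (1-q^ j ⊙ X) x)
               (sym (+-assoc (suc s * suc m) (tri s) (suc s)))
               (trans (+-suc (suc s) d) (cong suc (sym eq))) ⟩
    shift (a + suc s) (1-q^ suc m ⊙ X) x
      ≡⟨ shift-⊙ (a + suc s) (suc m) X x ⟩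
    B ⊕ C ∎
  e-A : ∀ s m t → suc s * suc m + t ≡ suc s * m + (t + suc s)
  e-A = solve-∀
  e-C : ∀ s m t → suc s * suc m + t + suc s + suc m ≡ suc (suc s) * suc m + (t + suc s)
  e-C = solve-∀
  cancel-middle : ∀ w x y z → w ⊕ (x ⊕ y) ⊕ (y ⊕ z) ≡ w ⊕ x ⊕ z
  cancel-middle w x y z = begin
    w ⊕ (x ⊕ y) ⊕ (y ⊕ z)  ≡⟨ cong (_⊕ (y ⊕ z)) (ℙ.+-assoc w x y) ⟨
    w ⊕ x ⊕ y ⊕ (y ⊕ z)    ≡⟨ ℙ.+-assoc (w ⊕ x) y (y ⊕ z) ⟩
    w ⊕ x ⊕ (y ⊕ (y ⊕ z))  ≡⟨ cong (w ⊕ x ⊕_) (ℙ.+-assoc y y z) ⟨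
    w ⊕ x ⊕ (y ⊕ y ⊕ z)    ≡⟨ cong (λ u → w ⊕ x ⊕ (u ⊕ z)) (ℙ.p+p≡0ℙ y) ⟩
    w ⊕ x ⊕ z              ∎

-- At `s = m`, `d = 0` the product in the correction is empty, so it is a single power of q; the top
-- summand for `n` is another. Their exponents are the two generalized pentagonal numbers of index
-- `n`.
shanks-suc : ∀ m → let n = suc m in
  shanks n n 0 ≗ shanks m m 0 ⊞ shift (n * n + tri m) (reduce (q^ 0))
                             ⊞ shift (n * n + tri n) (reduce (q^ 0))
shanks-suc m x =
  cong (_⊕ shift (suc m * suc m + tri (suc m)) (reduce (q^ 0)) x)
       (shanks-step m m 0 (sym (+-identityʳ m)) x)

-- Every summand with j ≥ 1 starts in degree at least n + 1, so up to degree `n` only the summand j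
-- = 0 contributes.
shanks-below : ∀ n s d x → x ≤ n → shanks n s d x ≡ segment 0 (s + d) x
shanks-below n zero    d x x≤n = refl
shanks-below n (suc s) d x x≤n = begin
  shanks n s (suc d) x ⊕ shift e (segment (suc s) d) x
    ≡⟨ cong₂ _⊕_ (shanks-below n s (suc d) x x≤n) (shift-below (segment (suc s) d) x<e) ⟩
  segment 0 (s + suc d) x ⊕ 0ℙ
    ≡⟨ ℙ.+-identityʳ _ ⟩
  segment 0 (s + suc d) x
    ≡⟨ cong (λ i → segment 0 i x) (+-suc s d) ⟩
  segment 0 (suc s + d) x ∎
  where
  open ≡-Reasoning
  e = suc s * n + tri (suc s)
  x<e : x < e
  x<e = ≤-<-trans (≤-trans x≤n (m≤n*m n (suc s)))
          (m<m+n (suc s * n) (≤-trans (s≤s z≤n) (m≤n+m (suc s) (tri s))))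

shift-q^0 : ∀ d n → shift d (reduce (q^ 0)) n ≡ 1ℙ → n ≡ d
shift-q^0 zero    zero    _  = refl
shift-q^0 (suc d) (suc n) eq = cong suc (shift-q^0 d n eq)

+≡1ℙ : ∀ x y → x ⊕ y ≡ 1ℙ → x ≡ 1ℙ ⊎ y ≡ 1ℙ
+≡1ℙ 0ℙ y eq = inj₂ eq
+≡1ℙ 1ℙ y eq = inj₁ refl

-- By `shanks-suc` the series is a sum of powers of q with pentagonal exponents, and an odd
-- coefficient must come from one of them.
shanks-odd⇒square : ∀ n x → shanks n n 0 x ≡ 1ℙ → ∃[ y ] 24 * x + 1 ≡ y * y
shanks-odd⇒square zero    x odd = 1 , cong (λ x → 24 * x + 1) (shift-q^0 0 x odd)
shanks-odd⇒square (suc m) x odd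
  with +≡1ℙ _ _ (trans (sym (shanks-suc m x)) odd)
... | inj₂ odd⁺ = 6 * suc m + 1 ,
  trans (cong (λ x → 24 * x + 1) (shift-q^0 (suc m * suc m + tri (suc m)) x odd⁺))
        (pentagonal⁺ (suc m))
... | inj₁ odd′ with +≡1ℙ _ _ odd′
...   | inj₁ odd₀ = shanks-odd⇒square m x odd₀
...   | inj₂ odd⁻ = 6 * m + 5 ,
  trans (cong (λ x → 24 * x + 1) (shift-q^0 (suc m * suc m + tri m) x odd⁻))
        (pentagonal⁻ m)

f₁-odd⇒square : ∀ n → par (f 1 n) ≡ 1ℙ → ∃[ y ] 24 * n + 1 ≡ y * y
f₁-odd⇒square n odd = shanks-odd⇒square n n (begin
  shanks n n 0 n       ≡⟨ shanks-below n n 0 n ≤-refl ⟩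
  segment 0 (n + 0) n  ≡⟨ cong (λ i → segment 0 i n) (+-identityʳ n) ⟩
  segment 0 n n        ≡⟨ reduce-qProduct-1 n n ⟨
  par (f 1 n)          ≡⟨ odd ⟩
  1ℙ                   ∎)
  where open ≡-Reasoning

-- Arithmetic of the exponents

-- The exponent of `p` in a square is even. Since `p` divides `y * y`, it divides `y`; cancelling p²
-- lowers the odd exponent by 2, until a single `p` is left and the second factor `p` of the square
-- has to divide `c`.
square≡p^odd*c⇒p∣c : ∀ {p} → Prime p → ∀ k {c} y → y * y ≡ p ^ (2 * k + 1) * c → p ℕ.∣ c
square≡p^odd*c⇒p∣c {p} pr k {c} y eq
  with [ id , id ]′ (euclidsLemma y y pr
         (subst (p ℕ.∣_) (sym eq) (∣m⇒∣m*n c (subst (λ e → p ℕ.∣ p ^ e) (+-comm 1 (2 * k)) (m∣m*n _)))))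
... | divides z refl = descend k eq
  where
  open ≡-Reasoning
  instance _ = prime⇒nonZero pr
  regroup : ∀ z p → z * p * (z * p) ≡ p * (p * (z * z))
  regroup = solve-∀
  regroup′ : ∀ p q c → p * (p * q) * c ≡ p * (p * (q * c))
  regroup′ = solve-∀
  exponent : ∀ k → 2 * suc k + 1 ≡ 2 + (2 * k + 1)
  exponent = solve-∀
  descend : ∀ k → z * p * (z * p) ≡ p ^ (2 * k + 1) * c → p ℕ.∣ c
  descend zero    eq = divides (z * z) (*-cancelˡ-≡ c (z * z * p) p (begin
    p * c              ≡⟨ cong (_* c) (*-identityʳ p) ⟨
    p * 1 * c          ≡⟨ eq ⟨
    z * p * (z * p)    ≡⟨ regroup z p ⟩
    p * (p * (z * z))  ≡⟨ cong (p *_) (*-comm p (z * z)) ⟩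
    p * (z * z * p)    ∎))
  descend (suc k) eq = square≡p^odd*c⇒p∣c pr k z
    (*-cancelˡ-≡ _ _ p (*-cancelˡ-≡ _ _ p (begin
      p * (p * (z * z))                ≡⟨ regroup z p ⟨
      z * p * (z * p)                  ≡⟨ eq ⟩
      p ^ (2 * suc k + 1) * c          ≡⟨ cong (λ e → p ^ e * c) (exponent k) ⟩
      p * (p * p ^ (2 * k + 1)) * c    ≡⟨ regroup′ p (p ^ (2 * k + 1)) c ⟩
      p * (p * (p ^ (2 * k + 1) * c))  ∎)))

-- The witness (p² - 1)/24 is itself a generalized pentagonal number, g(3g+1)/2 or g(3g-1)/2.
6g±1-square : ∀ {p} g → 1 ≤ g → (p ≡ 6 * g + 1) ⊎ (p ≡ 6 * g ∸ 1) → ∃[ w ] p * p ≡ 24 * w + 1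
6g±1-square g       1≤g (inj₁ refl) = g * g + tri g , sym (pentagonal⁺ g)
6g±1-square (suc h) 1≤g (inj₂ refl) = suc h * suc h + tri h ,
  trans (cong (λ x → (x ∸ 1) * (x ∸ 1)) (lemma h)) (sym (pentagonal⁻ h))
  where
  lemma : ∀ h → 6 * suc h ≡ suc (6 * h + 5)
  lemma = solve-∀

^-≡1-mod-24 : ∀ {a} w → a ≡ 24 * w + 1 → ∀ j → ∃[ v ] a ^ j ≡ 24 * v + 1
^-≡1-mod-24 w eq zero    = 0 , refl
^-≡1-mod-24 w eq (suc j) with ^-≡1-mod-24 w eq j
... | v , eqᵛ = 24 * w * v + w + v , trans (cong₂ _*_ eq eqᵛ) (lemma 24 w v)
  where
  lemma : ∀ c w v → (c * w + 1) * (c * v + 1) ≡ c * (c * w * v + w + v) + 1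
  lemma = solve-∀

-- The floor division is exact because `n` is 1 modulo 24.
24*[n∸1]/24+1 : ∀ {n} v → n ≡ 24 * v + 1 → 24 * ((n ∸ 1) / 24) + 1 ≡ n
24*[n∸1]/24+1 v refl = cong (λ x → 24 * x + 1) (begin
  (24 * v + 1 ∸ 1) / 24  ≡⟨ cong (_/ 24) (m+n∸n≡m (24 * v) 1) ⟩
  24 * v / 24            ≡⟨ cong (_/ 24) (*-comm 24 v) ⟩
  v * 24 / 24            ≡⟨ m*n/n≡m v 24 ⟩
  v                      ∎)
  where open ≡-Reasoning

-- Otherwise `p` divides 24 or `p * n + r`. In the first case it divides both p² = 24w + 1 and 24w,
-- hence 1; in the second it divides `r`, which lies strictly between 0 and `p`.
p∤p+24[pn+r] : ∀ {p} → Prime p → ∀ w → p * p ≡ 24 * w + 1 →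
  ∀ n r → 1 ≤ r → r ≤ p ∸ 1 → ¬ p ℕ.∣ p + 24 * (p * n + r)
-- Matching `r` as a successor provides the nonzeroness that `∣⇒≤` asks for.
p∤p+24[pn+r] {p} pr w p² n r@(suc _) 1≤r r≤p∸1 p∣
  with euclidsLemma 24 (p * n + r) pr (∣m+n∣m⇒∣n p∣ ∣-refl)
... | inj₁ p∣24   = contradiction p≡1 (nonTrivial⇒≢1 {{prime⇒nonTrivial pr}})
  where
  p≡1 = ∣1⇒≡1 (∣m+n∣m⇒∣n (subst (p ℕ.∣_) p² (m∣m*n p)) (∣m⇒∣m*n w p∣24))
... | inj₂ p∣pn+r = contradiction (∣⇒≤ (∣m+n∣m⇒∣n p∣pn+r (m∣m*n n))) (<⇒≱ r<p)
  where
  r<p = ≤-trans (s≤s r≤p∸1) (≤-reflexive (suc-pred p {{prime⇒nonZero pr}}))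

-- An odd value would make 24m + 1 a square, in which `p` cannot have the odd exponent 2k + 1.
EOᵤ-4*-even : ∀ {p} → Prime p → ∀ k m {c} →
  24 * m + 1 ≡ p ^ (2 * k + 1) * c → ¬ p ℕ.∣ c → + 2 ∣ EOᵤ (4 * m)
EOᵤ-4*-even pr k m {c} eq p∤c =
  parity≡0⇒2∣ ∣ EOᵤ (4 * m) ∣ (trans (EOᵤ-4* m) (f₁-even (par (f 1 m)) refl))
  where
  -- Splitting on a copy `x` of the parity keeps the equation for `par (f 1 m)` at hand.
  f₁-even : ∀ x → par (f 1 m) ≡ x → par (f 1 m) ≡ 0ℙ
  f₁-even 0ℙ even = even
  f₁-even 1ℙ odd with f₁-odd⇒square m odd
  ... | y , square = contradiction (square≡p^odd*c⇒p∣c pr k y (trans (sym square) eq)) p∤c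

-- The power is (p²)^(k+1), and powers of a number that is 1 modulo 24 stay 1 modulo 24.
24*[p^[2k+2]∸1]/24+1 : ∀ p w → p * p ≡ 24 * w + 1 → ∀ k →
  24 * ((p ^ (2 * k + 2) ∸ 1) / 24) + 1 ≡ p ^ (2 * k + 2)
24*[p^[2k+2]∸1]/24+1 p w p² k =
  24*[n∸1]/24+1 (proj₁ power) (trans (sym [p²]^) (proj₂ power))
  where
  open ≡-Reasoning
  power : ∃[ v ] (p * p) ^ suc k ≡ 24 * v + 1
  power = ^-≡1-mod-24 w p² (suc k)
  [p²]^ : (p * p) ^ suc k ≡ p ^ (2 * k + 2)
  [p²]^ = begin
    (p * p) ^ suc k  ≡⟨ cong (λ x → (p * x) ^ suc k) (*-identityʳ p) ⟨
    (p ^ 2) ^ suc k  ≡⟨ ^-*-assoc p 2 (suc k) ⟩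
    p ^ (2 * suc k)  ≡⟨ cong (p ^_) (trans (*-suc 2 k) (+-comm 2 (2 * k))) ⟩
    p ^ (2 * k + 2)  ∎

-- The added 1 joins 24t to form `Q`, after which `P` is a common factor. In the application `P` is
-- the odd power p^(2k+1) and the cofactor is prime to `p`.
24*exponent+1 : ∀ p P {Q} t → Q ≡ p * P → 24 * t + 1 ≡ Q → ∀ n r →
  24 * (Q * n + P * r + t) + 1 ≡ P * (p + 24 * (p * n + r))
24*exponent+1 p P {Q} t Q≡pP 24t+1≡Q n r = begin
  24 * (Q * n + P * r + t) + 1         ≡⟨ separate 24 (Q * n + P * r) t ⟩
  24 * (Q * n + P * r) + (24 * t + 1)  ≡⟨ cong (λ x → 24 * (Q * n + P * r) + x) 24t+1≡Q ⟩
  24 * (Q * n + P * r) + Q             ≡⟨ cong (λ x → 24 * (x * n + P * r) + x) Q≡pP ⟩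
  24 * (p * P * n + P * r) + p * P     ≡⟨ factor 24 p P n r ⟩
  P * (p + 24 * (p * n + r))           ∎
  where
  open ≡-Reasoning
  separate : ∀ c a t → c * (a + t) + 1 ≡ c * a + (c * t + 1)
  separate = solve-∀
  factor : ∀ c p P n r → c * (p * P * n + P * r) + p * P ≡ P * (p + c * (p * n + r))
  factor = solve-∀

theorem3p3 : ∀ (p g : ℕ) → Prime p → 1 ≤ g → (p ≡ 6 * g + 1) ⊎ (p ≡ 6 * g ∸ 1) →
    ∀ (n k r : ℕ) → 1 ≤ r → r ≤ p ∸ 1 →
    + 2 ∣ EOᵤ (4 * (p ^ (2 * k + 2) * n + p ^ (2 * k + 1) * r + (p ^ (2 * k + 2) ∸ 1) / 24))
theorem3p3 p g pr 1≤g p≡ n k r 1≤r r≤p∸1 =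
  EOᵤ-4*-even pr k (Q * n + P * r + t)
    (24*exponent+1 p P t (cong (p ^_) (+-suc (2 * k) 1))
      (24*[p^[2k+2]∸1]/24+1 p (proj₁ p²) (proj₂ p²) k) n r)
    (p∤p+24[pn+r] pr (proj₁ p²) (proj₂ p²) n r 1≤r r≤p∸1)
  where
  P = p ^ (2 * k + 1)
  Q = p ^ (2 * k + 2)
  t = (Q ∸ 1) / 24
  p² : ∃[ w ] p * p ≡ 24 * w + 1
  p² = 6g±1-square g 1≤g p≡
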